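{- Let $n\ge 3$ be an integer. If $n \geq 3$ is odd, then $\mathrm{ParseWords}(\mathrm{LeftCombTree}(n), \mathrm{LeftCrookedTree}(n))$ equals \[\left\{ \mathrm{mod}(2-n,3) \left((012)^{(n-1)/6}\right)^R (012)^{(n-3)/6}\, \mathrm{mod}(2-n,3),\;\; \mathrm{mod}(2-n,3) \left((012)^{(n-1)/6}\right)^R (012)^{(n-3)/6}\, \mathrm{mod}(-n,3) \right\},\] and if $n \geq 4$ is even, then $\mathrm{ParseWords}(\mathrm{LeftCombTree}(n), \mathrm{LeftCrookedTree}(n))$ equals \[\left\{ \mathrm{mod}(2-n,3) \left((012)^{(n-4)/6}\right)^R (012)^{n/6}\, \mathrm{mod}(2-n,3),\;\; \mathrm{mod}(2-n,3) \left((012)^{(n-4)/6}\right)^R (012)^{n/6}\, \mathrm{mod}(-n,3) \right\}.\] (Sets of equivalence classes are written by listing one representative of each class; juxtaposition is concatenation, each value $\mathrm{mod}(\cdot,3)\in\{0,1,2\}$ being a single letter.)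
   Context: A binary tree is a rooted ordered tree in which each vertex has either $0$ or $2$ children; its leaves are ordered left to right. Let $G$ be the context-free grammar with start symbols $0,1,2$ and rules $0\to 12$, $0\to 21$, $1\to 02$, $1\to 20$, $2\to 01$, $2\to 10$. An $n$-leaf binary tree $T$ parses a word $w$ of length $n$ on $\{0,1,2\}$ if there is a labeling of the vertices of $T$ by $0,1,2$ such that the leaves, from left to right, are labeled with the letters of $w$, and at every internal vertex the label of the vertex together with the labels of its left and right children form a rule of $G$ (i.e. the three labels are pairwise distinct). If $T$ parses $w$, it also parses every word obtained from $w$ by permuting the alphabet $\{0,1,2\}$. For $n$-leaf binary trees $T_1,T_2$, $\mathrm{ParseWords}(T_1,T_2)$ denotes the set of equivalence classes (under permutations of the alphabet $\{0,1,2\}$) of words parsed by both $T_1$ and $T_2$; it is written by listing one representative of each class. If $w=w_1\cdots w_m$ is a word of length $m$ and $x\ge 0$ is a rational number whose denominator in lowest terms divides $m$, then $w^x = w^{\lfloor x\rfloor} w_1 w_2\cdots w_{m(x-\lfloor x\rfloor)}$ is the word of length $mx$ consisting of repeated copies of $w$ truncated at $mx$ letters. $w^R$ is the left–right reversal of $w$. $\mathrm{mod}(a,3)$ is the smallest nonnegative integer congruent to $a$ modulo $3$. The level of a vertex is its distance from the root. A path tree is a binary tree with at most two vertices on each level. For $n\ge 2$, $n$-leaf path trees correspond bijectively to words $x_1\cdots x_{n-2}$ on $\{l,r\}$: $x_j=l$ (resp. $x_j=r$) means that, of the two vertices on level $j$, the left (resp. right) one has children. $\mathrm{LeftCombTree}(n)$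 is the $n$-leaf path tree corresponding to $l^{n-2}$. $\mathrm{LeftCrookedTree}(n)$ is the $n$-leaf path tree corresponding to $(lr)^{(n-2)/2}$, i.e. the word $lrlr\cdots$ of length $n-2$. -}

module Defs where

open import Data.Fin using (Fin; fromℕ<)
open import Data.Fin.Patterns using (0F; 1F; 2F)
open import Data.Fin.Permutation using (Permutation′; _⟨$⟩ʳ_)
open import Data.Integer as ℤ using (ℤ; +_)
open import Data.Integer.DivMod using (n%ℕd<d)
open import Data.List using (List; []; _∷_; _++_; concat; length; map; replicate; take)
open import Data.List.Membership.Propositional using (_∈_)
open import Data.Nat as ℕ using (ℕ; zero; suc; s≤s; z≤n)
open import Data.Nat.Properties using (≤-refl; +-identityʳ; +-comm)
open import Data.Product using (∃; ∃-syntax; _×_)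
open import Data.Rational.Unnormalised as ℚᵘ using (ℚᵘ; _/_)
open import Data.Unit using (⊤)
open import Level using (0ℓ)
open import Relation.Binary.PropositionalEquality using (_≡_; refl; sym; trans; cong; subst)
open import Relation.Unary using (Pred; _∩_)

Letter : Set
Letter = Fin 3

Word : Set
Word = List Letter

w012 : Word
w012 = 0F ∷ 1F ∷ 2F ∷ []

mod₃ : ℤ → Letter
mod₃ a = fromℕ< (n%ℕd<d a 3)

-- The second summand has m (x − ⌊x⌋) letters, where m = length w.  That number
-- is a natural number when x ≥ 0 has a denominator dividing m, which is the
-- only case in which the power is meaningful; the outer floor then merely
-- converts it from ℚᵘ to ℤ.
infixr 8 _^_
_^_ : {A : Set} → List A → ℚᵘ → List A
w ^ x = concat (replicate ℤ.∣ ℚᵘ.floor x ∣ w)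
     ++ take ℤ.∣ ℚᵘ.floor ((+ length w / 1) ℚᵘ.* (x ℚᵘ.- (ℚᵘ.floor x / 1))) ∣ w

data BinTree : Set where
  leaf : BinTree
  node : BinTree → BinTree → BinTree

leafCount : BinTree → ℕ
leafCount leaf       = 1
leafCount (node t u) = leafCount t ℕ.+ leafCount u

-- Number of vertices at a given distance from the root.
levelWidth : BinTree → ℕ → ℕ
levelWidth _          zero    = 1
levelWidth leaf       (suc k) = 0
levelWidth (node t u) (suc k) = levelWidth t k ℕ.+ levelWidth u k

IsPathTree : BinTree → Set
IsPathTree T = ∀ k → levelWidth T k ℕ.≤ 2

data Dir : Set where
  l r : Dir

-- The head of the list describes level 1: it names the child of the root that
-- has children itself.
pathTree : List Dir → BinTree
pathTree []      = node leaf leaf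
pathTree (l ∷ x) = node (pathTree x) leaf
pathTree (r ∷ x) = node leaf (pathTree x)

leafCount-pathTree : ∀ x → leafCount (pathTree x) ≡ 2 ℕ.+ length x
leafCount-pathTree []      = refl
leafCount-pathTree (l ∷ x) = trans (+-comm _ 1) (cong suc (leafCount-pathTree x))
leafCount-pathTree (r ∷ x) = cong suc (leafCount-pathTree x)

pathTree-isPathTree : ∀ x → IsPathTree (pathTree x)
pathTree-isPathTree []      zero          = s≤s z≤n
pathTree-isPathTree []      (suc zero)    = ≤-refl
pathTree-isPathTree []      (suc (suc k)) = z≤n
pathTree-isPathTree (l ∷ x) zero          = s≤s z≤n
pathTree-isPathTree (l ∷ x) (suc zero)    = ≤-refl
pathTree-isPathTree (l ∷ x) (suc (suc k)) =
  subst (ℕ._≤ 2) (sym (+-identityʳ _)) (pathTree-isPathTree x (suc k))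
pathTree-isPathTree (r ∷ x) zero          = s≤s z≤n
pathTree-isPathTree (r ∷ x) (suc zero)    = ≤-refl
pathTree-isPathTree (r ∷ x) (suc (suc k)) = pathTree-isPathTree x (suc k)

-- These have n leaves only for n ≥ 2.
LeftCombTree : ℕ → BinTree
LeftCombTree n = pathTree (replicate (n ℕ.∸ 2) l)

LeftCrookedTree : ℕ → BinTree
LeftCrookedTree n = pathTree ((l ∷ r ∷ []) ^ ((+ n ℤ.- + 2) / 2))

infix 4 _⟶_∙_
data _⟶_∙_ : Letter → Letter → Letter → Set where
  0⟶12 : 0F ⟶ 1F ∙ 2F
  0⟶21 : 0F ⟶ 2F ∙ 1F
  1⟶02 : 1F ⟶ 0F ∙ 2F
  1⟶20 : 1F ⟶ 2F ∙ 0F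
  2⟶01 : 2F ⟶ 0F ∙ 1F
  2⟶10 : 2F ⟶ 1F ∙ 0F

-- An assignment of a letter to every vertex of the tree.
data Labeling : BinTree → Set where
  leaf : Letter → Labeling leaf
  node : ∀ {t u} → Letter → Labeling t → Labeling u → Labeling (node t u)

rootLabel : ∀ {T} → Labeling T → Letter
rootLabel (leaf a)     = a
rootLabel (node a _ _) = a

leafWord : ∀ {T} → Labeling T → Word
leafWord (leaf a)     = a ∷ []
leafWord (node _ t u) = leafWord t ++ leafWord u

Valid : ∀ {T} → Labeling T → Set
Valid (leaf _)     = ⊤
Valid (node a t u) = a ⟶ rootLabel t ∙ rootLabel u × Valid t × Valid u

Parses : BinTree → Pred Word 0ℓ
Parses T w = ∃[ λ′ ] Valid {T} λ′ × leafWord λ′ ≡ w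

infix 4 _∼_
_∼_ : Word → Word → Set
u ∼ w = ∃ λ (σ : Permutation′ 3) → map (σ ⟨$⟩ʳ_) u ≡ w

-- A set of ∼-classes is represented by the ∼-closed predicate of belonging to
-- one of its classes, so that equality of sets of classes becomes _≐_.
-- Classes P represents { [u] | P u }.
Classes : Pred Word 0ℓ → Pred Word 0ℓ
Classes P w = ∃[ u ] P u × u ∼ w

ParseWords : BinTree → BinTree → Pred Word 0ℓ
ParseWords T₁ T₂ = Classes (Parses T₁ ∩ Parses T₂)

-- The set of classes listed by representatives.
ClassesOf : List Word → Pred Word 0ℓ
ClassesOf ws = Classes (_∈ ws)

{-# OPTIONS --safe #-}
-- Identify 0, 1, 2 with the nonzero elements of F₄, so that x ⟶ y ∙ z means
-- x = y + z, and record a word by its prefix sums p₁, p₂, ….  Being parsed by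
-- the left comb says that these form a walk with pᵢ ≠ pᵢ₊₁, and a subtree over
-- the letters i+1, …, j is labelled pᵢ + pⱼ.  Hence the left crooked tree adds
-- a zigzag of inequalities between p₁, …, pₙ₋₁ whose graph is a triangulated
-- polygon: its 3-colouring is unique up to a permutation of the letters, and
-- the only other constraint, pₙ ≠ pₙ₋₁, leaves two words.
module Submission where

open import Defs
open import Data.Empty using (⊥-elim)
open import Data.Fin.Patterns using (0F; 1F; 2F)
open import Data.Fin.Permutation using (Permutation′; _⟨$⟩ʳ_; transpose; _∘ₚ_; flip; inverseˡ)
  renaming (id to idₚ)
open import Data.Integer using (+_; _-_; -_; -[1+_]; ∣_∣) renaming (_+_ to _+ℤ_; _*_ to _*ℤ_)
import Data.Integer.Properties as ℤ
open import Data.List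
  using (List; []; _∷_; _++_; _∷ʳ_; reverse; [_]; map; length; concat; replicate; take;
         applyUpTo; applyDownFrom; initLast; _∷ʳ′_)
open import Data.List.Properties
  using (++-assoc; map-++; map-∘; map-cong; map-id; length-++; ∷-injective;
         applyUpTo-∷ʳ; reverse-applyUpTo)
open import Data.List.Relation.Unary.Any using (here; there)
open import Data.Nat using (ℕ; zero; suc; _+_; _*_; _%_; _≤_; s≤s) renaming (_/_ to _/ℕ_)
open import Data.Nat.Divisibility using (_∣_; _∤_; divides; ∣-refl)
open import Data.Nat.DivMod using (m≡m%n+[m/n]*n; [m+n]%n≡m%n; +-distrib-/-∣ˡ; n/n≡1; m%n<n)
open import Data.Nat.Properties using (+-comm; suc-injective)
open import Data.Product using (∃; ∃-syntax; _×_; _,_; proj₁; proj₂)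
open import Data.Rational.Unnormalised using (_/_; floor) renaming (_*_ to _*ℚ_)
open import Data.Sum using (_⊎_; inj₁; inj₂; [_,_]′)
open import Data.Unit using (tt)
open import Relation.Binary.PropositionalEquality
  using (_≡_; refl; sym; trans; cong; cong₂; subst₂; module ≡-Reasoning)
open import Relation.Unary using (_≐_)

private
  variable
    a b c d e s x y z : Letter
    u v w : Word
    T : BinTree

-- Rules of the grammar

⟶-rotate : a ⟶ b ∙ c → b ⟶ c ∙ a
⟶-rotate 0⟶12 = 1⟶20
⟶-rotate 0⟶21 = 2⟶10
⟶-rotate 1⟶02 = 0⟶21
⟶-rotate 1⟶20 = 2⟶01
⟶-rotate 2⟶01 = 0⟶12
⟶-rotate 2⟶10 = 1⟶02

⟶-swap : a ⟶ b ∙ c → a ⟶ c ∙ b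
⟶-swap 0⟶12 = 0⟶21
⟶-swap 0⟶21 = 0⟶12
⟶-swap 1⟶02 = 1⟶20
⟶-swap 1⟶20 = 1⟶02
⟶-swap 2⟶01 = 2⟶10
⟶-swap 2⟶10 = 2⟶01

⟶-exchange : c ⟶ a ∙ b → b ⟶ a ∙ c
⟶-exchange h = ⟶-rotate (⟶-swap h)

⟶-functional : a ⟶ x ∙ y → b ⟶ x ∙ y → a ≡ b
⟶-functional 0⟶12 0⟶12 = refl
⟶-functional 0⟶21 0⟶21 = refl
⟶-functional 1⟶02 1⟶02 = refl
⟶-functional 1⟶20 1⟶20 = refl
⟶-functional 2⟶01 2⟶01 = refl
⟶-functional 2⟶10 2⟶10 = refl

-- The last two rules make `y` differ from `d` and `x`; the first leaves only `a`.
⟶-missing : d ⟶ a ∙ x → e ⟶ d ∙ y → s ⟶ x ∙ y → y ≡ a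
⟶-missing 0⟶12 1⟶02 ()
⟶-missing 0⟶12 2⟶01 _ = refl
⟶-missing 0⟶21 2⟶01 ()
⟶-missing 0⟶21 1⟶02 _ = refl
⟶-missing 1⟶02 0⟶12 ()
⟶-missing 1⟶02 2⟶10 _ = refl
⟶-missing 1⟶20 2⟶10 ()
⟶-missing 1⟶20 0⟶12 _ = refl
⟶-missing 2⟶01 0⟶21 ()
⟶-missing 2⟶01 1⟶20 _ = refl
⟶-missing 2⟶10 1⟶20 ()
⟶-missing 2⟶10 0⟶21 _ = refl

⟶-other : c ⟶ a ∙ b → d ⟶ b ∙ y → y ≡ a ⊎ y ≡ c
⟶-other 0⟶12 0⟶21 = inj₁ refl
⟶-other 0⟶12 1⟶20 = inj₂ refl
⟶-other 0⟶21 0⟶12 = inj₁ refl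
⟶-other 0⟶21 2⟶10 = inj₂ refl
⟶-other 1⟶02 0⟶21 = inj₂ refl
⟶-other 1⟶02 1⟶20 = inj₁ refl
⟶-other 1⟶20 1⟶02 = inj₁ refl
⟶-other 1⟶20 2⟶01 = inj₂ refl
⟶-other 2⟶01 0⟶12 = inj₂ refl
⟶-other 2⟶01 2⟶10 = inj₁ refl
⟶-other 2⟶10 1⟶02 = inj₂ refl
⟶-other 2⟶10 2⟶01 = inj₁ refl

-- Walks of prefix sums

-- Starting at the prefix sum a and reading w, one reaches b without ever
-- meeting the sum 0.
data Walk : Letter → Word → Letter → Set where
  []  : Walk a [] a
  _∷_ : c ⟶ a ∙ x → Walk c w b → Walk a (x ∷ w) b

walk-++⁺ : Walk a u c → Walk c v b → Walk a (u ++ v) b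
walk-++⁺ []      q = q
walk-++⁺ (h ∷ p) q = h ∷ walk-++⁺ p q

walk-++⁻ : ∀ u → Walk a (u ++ v) b → ∃[ c ] Walk a u c × Walk c v b
walk-++⁻ []      q       = _ , [] , q
walk-++⁻ (x ∷ u) (h ∷ q) with c , p , q′ ← walk-++⁻ u q = c , h ∷ p , q′

walk-∷ʳ⁻ : ∀ u → Walk a (u ∷ʳ x) b → ∃[ c ] Walk a u c × b ⟶ c ∙ x
walk-∷ʳ⁻ u q with c , p , h ∷ [] ← walk-++⁻ u q = c , p , h

walk-tree : (t : Labeling T) → Valid t → Walk a (leafWord t) b → b ⟶ a ∙ rootLabel t
walk-tree (leaf x) _ (h ∷ []) = h
walk-tree (node s t u) (q , vt , vu) p
  with c , p₁ , p₂ ← walk-++⁻ (leafWord t) p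
  with h₁ ← walk-tree t vt p₁ | h₂ ← walk-tree u vu p₂
  -- The label of `u` is forced to be `a` and that of the node to be `c`, so `h₂` with its summands
  -- exchanged is the claim.
  with refl ← ⟶-missing h₁ h₂ q
  with refl ← ⟶-functional h₁ (⟶-swap q)
  = ⟶-swap h₂

-- The left comb

-- From the bottom up, the labels on the left spine are the prefix sums of the word, after the first
-- letter itself.
comb-walk : ∀ m (t : Labeling (pathTree (replicate m l))) → Valid t →
  ∃[ x ] ∃[ v ] leafWord t ≡ x ∷ v × Walk x v (rootLabel t)
comb-walk zero    (node s (leaf x) (leaf y)) (h , _) = x , [ y ] , refl , h ∷ []
comb-walk (suc m) (node s t (leaf y)) (h , vt , _)
  with x , v , eq , p ← comb-walk m t vt
  = x , v ∷ʳ y , cong (_∷ʳ y) eq , walk-++⁺ p (h ∷ [])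

walk-comb : ∀ m v → length v ≡ suc m → Walk x v s →
  ∃[ t ] Valid {pathTree (replicate m l)} t × leafWord t ≡ x ∷ v × rootLabel t ≡ s
walk-comb {x} zero (y ∷ []) _ (h ∷ []) =
  node _ (leaf x) (leaf y) , (h , tt , tt) , refl , refl
-- The root of the comb holds the last letter, so letters are removed from the right although `Walk`
-- is built from the left.
walk-comb (suc m) v len p with initLast v
walk-comb (suc m) .(v ∷ʳ y) len p | v ∷ʳ′ y
  with c , q , h ← walk-∷ʳ⁻ v p
  with t , vt , eq , refl ← walk-comb m v
         (suc-injective (trans (sym (trans (length-++ v) (+-comm (length v) 1))) len)) q
  = node _ t (leaf y) , (h , vt , tt) , cong (_∷ʳ y) eq , refl

-- The left crooked tree

-- crook m has m + 1 leaves; in contrast to LeftCrookedTree this includes the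
-- one-leaf tree, as needed to remove two leaves at a time.
crook : ℕ → BinTree
crook 0             = leaf
crook 1             = node leaf leaf
crook (suc (suc m)) = node (node leaf (crook m)) leaf

-- The word that crook m parses with root label c and that leads from the
-- prefix sum a to the prefix sum b.
middle : ℕ → Letter → Letter → Letter → Word
middle 0             a b c = [ c ]
middle 1             a b c = b ∷ a ∷ []
middle (suc (suc m)) a b c = c ∷ (middle m b c a ∷ʳ a)

length-middle : ∀ m → length (middle m a b c) ≡ suc m
length-middle 0 = refl
length-middle 1 = refl
length-middle (suc (suc m)) =
  cong suc (trans (length-++ (middle m _ _ _)) (trans (+-comm _ 1) (cong suc (length-middle m))))

map-middle : ∀ m (f : Letter → Letter) → map f (middle m a b c) ≡ middle m (f a) (f b) (f c)
map-middle 0 f = refl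
map-middle 1 f = refl
map-middle {a} {c = c} (suc (suc m)) f =
  cong (f c ∷_) (trans (map-++ f (middle m _ _ _) [ a ]) (cong (_∷ʳ f a) (map-middle m f)))

-- In a layer, the first letter leads from `a` to `b`, the inner word from `b` to `c`, and the last
-- letter from `c` back to `b`.
middle-walk : ∀ m → c ⟶ a ∙ b → Walk a (middle m a b c) b
middle-walk 0 h = ⟶-exchange h ∷ []
middle-walk 1 h = h ∷ ⟶-rotate (⟶-rotate h) ∷ []
middle-walk (suc (suc m)) h =
  b⟶ac ∷ walk-++⁺ (middle-walk m (⟶-rotate h)) (⟶-swap b⟶ac ∷ [])
  where b⟶ac = ⟶-exchange h

middle-parsed : ∀ m → c ⟶ a ∙ b →
  ∃[ t ] Valid {crook m} t × leafWord t ≡ middle m a b c × rootLabel t ≡ c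
middle-parsed {c} 0 h = leaf c , tt , refl , refl
middle-parsed {c} {a} {b} 1 h =
  node c (leaf b) (leaf a) , (⟶-swap h , tt , tt) , refl , refl
middle-parsed {c} {a} {b} (suc (suc m)) h with middle-parsed m (⟶-rotate h)
... | t , vt , eq , refl =
  node c (node b (leaf c) t) (leaf a) ,
  (⟶-swap h , (⟶-rotate (⟶-rotate h) , tt , vt) , tt) ,
  cong (λ w → c ∷ (w ∷ʳ a)) eq , refl

-- A layer has the prefix sums `a`, `d`, `e`, `b` around its leaf `x`, its inner tree labelled `z`
-- and its leaf `y`. As `s` = `a` + `e` and `c` = `a` + `b` are nonzero, `a`, `d`, `e` and `a`, `e`,
-- `b` are triangles with a common edge, so `d` = `b` and `e` is the third letter.
crook-labels : d ⟶ a ∙ x → e ⟶ d ∙ z → s ⟶ x ∙ z → c ⟶ s ∙ y → b ⟶ e ∙ y →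
  x ≡ c × d ≡ b × e ≡ c × z ≡ a × y ≡ a
crook-labels p q h p′ q′
  with refl ← ⟶-missing p q h
  with refl ← ⟶-functional q (⟶-rotate (⟶-rotate p))
  with refl ← ⟶-functional h (⟶-swap p)
  with refl ← ⟶-missing p p′ q′
  with refl ← ⟶-functional q p′ | refl ← ⟶-functional h q′
  = refl , refl , refl , refl , refl

-- `crook-labels` fixes the outer leaves of a layer and hands the inner tree end sums and a root
-- label that are a rotation of the given ones.
crook-unique : ∀ m (t : Labeling (crook m)) → Valid t → Walk a (leafWord t) b →
  leafWord t ≡ middle m a b (rootLabel t)
crook-unique 0 (leaf x) _ _ = refl
crook-unique 1 (node c (leaf x) (leaf y)) (q , _) (h ∷ h′ ∷ [])
  with refl ← ⟶-missing h h′ q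
  = cong (_∷ _) (⟶-functional (⟶-rotate (⟶-rotate h)) h′)
crook-unique (suc (suc m)) (node c (node s (leaf x) t) (leaf y)) (q , (q′ , _ , vt) , _) (h ∷ p)
  with e , p₁ , h′ ← walk-∷ʳ⁻ (leafWord t) p
  with eq ← crook-unique m t vt p₁
  with x≡c , d≡b , e≡c , z≡a , y≡a ← crook-labels h (walk-tree t vt p₁) q′ q h′
  rewrite eq | x≡c | d≡b | e≡c | z≡a | y≡a
  = refl

-- Words parsed by both trees

-- The sum before the last letter is `b`, and the last letter may be anything else.
Candidate : ℕ → Letter → Letter → Letter → Word → Set
Candidate m a b c w = w ≡ a ∷ (middle m a b c ∷ʳ a) ⊎ w ≡ a ∷ (middle m a b c ∷ʳ c)

BothParse : ℕ → Word → Set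
BothParse m w = Parses (pathTree (replicate (suc m) l)) w × Parses (crook (2 + m)) w

bothParse⇒candidate : ∀ m → BothParse m w →
  ∃[ a ] ∃[ b ] ∃[ c ] c ⟶ a ∙ b × Candidate m a b c w
bothParse⇒candidate m ((t , vt , refl) , node _ (node _ (leaf x) u) (leaf y) , (_ , (_ , _ , vu) , _) , eq)
  with x′ , v , eq′ , p ← comb-walk (suc m) t vt
  with refl , refl ← ∷-injective (trans eq eq′)
  with e , p₁ , h ← walk-∷ʳ⁻ (leafWord u) p
  with h₁ ← walk-tree u vu p₁ | eqᵤ ← crook-unique m u vu p₁
  with h₂ ← ⟶-exchange h₁
  = x , e , rootLabel u , h₂ ,
    [ (λ y≡ → inj₁ (trans (sym eq) (cong₂ (λ w y → x ∷ (w ∷ʳ y)) eqᵤ y≡)))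
    , (λ y≡ → inj₂ (trans (sym eq) (cong₂ (λ w y → x ∷ (w ∷ʳ y)) eqᵤ y≡)))
    ]′ (⟶-other h₂ h)

parsed-by-both : ∀ m → c ⟶ a ∙ b → s ⟶ b ∙ y → BothParse m (a ∷ (middle m a b c ∷ʳ y))
parsed-by-both {c} {a} {b} {s} {y} m h h′
  with t , vt , eq , _ ← walk-comb (suc m) (middle m a b c ∷ʳ y)
         (trans (length-++ (middle m a b c)) (trans (+-comm _ 1) (cong suc (length-middle m))))
         (walk-++⁺ (middle-walk m h) (h′ ∷ []))
  with middle-parsed m h
... | u , vu , equ , refl =
  (t , vt , eq) ,
  -- Both vertices lie over prefixes of the word, so their labels are the prefix sums.
  (node s (node b (leaf a) u) (leaf y) ,
   (h′ , (⟶-exchange h , tt , vu) , tt) ,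
   cong (λ w → a ∷ (w ∷ʳ y)) equ)

candidate⇒bothParse : ∀ m → c ⟶ a ∙ b → Candidate m a b c w → BothParse m w
candidate⇒bothParse m h (inj₁ refl) = parsed-by-both m h (⟶-swap h)
candidate⇒bothParse m h (inj₂ refl) = parsed-by-both m h (⟶-rotate h)

-- Permutations of the alphabet

∼-sym : u ∼ v → v ∼ u
∼-sym {u} (σ , refl) = flip σ ,
  trans (sym (map-∘ u)) (trans (map-cong (λ _ → inverseˡ σ) u) (map-id u))

∼-trans : u ∼ v → v ∼ w → u ∼ w
∼-trans {u} (σ , refl) (τ , refl) = σ ∘ₚ τ , map-∘ u

letters-permutation : c ⟶ a ∙ b →
  ∃ λ (σ : Permutation′ 3) → (σ ⟨$⟩ʳ 0F) ≡ a × (σ ⟨$⟩ʳ 1F) ≡ b × (σ ⟨$⟩ʳ 2F) ≡ c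
letters-permutation 0⟶12 = transpose 0F 1F ∘ₚ transpose 0F 2F , refl , refl , refl
letters-permutation 0⟶21 = transpose 0F 2F , refl , refl , refl
letters-permutation 1⟶02 = transpose 1F 2F , refl , refl , refl
letters-permutation 1⟶20 = transpose 0F 2F ∘ₚ transpose 0F 1F , refl , refl , refl
letters-permutation 2⟶01 = idₚ , refl , refl , refl
letters-permutation 2⟶10 = transpose 0F 1F , refl , refl , refl

-- `middle` commutes with every map of letters, in particular with the permutation taking 0, 1, 2 to
-- `a`, `b`, `c`.
candidate∼standard : ∀ m → c ⟶ a ∙ b →
  (0F ∷ (middle m 0F 1F 2F ∷ʳ 0F) ∼ a ∷ (middle m a b c ∷ʳ a)) ×
  (0F ∷ (middle m 0F 1F 2F ∷ʳ 2F) ∼ a ∷ (middle m a b c ∷ʳ c))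
candidate∼standard m h with σ , refl , refl , refl ← letters-permutation h =
  (σ , image 0F) , (σ , image 2F)
  where
  f = σ ⟨$⟩ʳ_
  image : ∀ y → map f (0F ∷ (middle m 0F 1F 2F ∷ʳ y)) ≡ f 0F ∷ (middle m (f 0F) (f 1F) (f 2F) ∷ʳ f y)
  image y = cong (f 0F ∷_) (trans (map-++ f (middle m _ _ _) [ y ]) (cong (_∷ʳ f y) (map-middle m f)))

candidates : ℕ → Letter → Letter → Letter → List Word
candidates m a b c = (a ∷ (middle m a b c ∷ʳ a)) ∷ (a ∷ (middle m a b c ∷ʳ c)) ∷ []

-- All rules give the same two classes, by comparison with 0, 1, 2. Keeping `a`, `b`, `c` free
-- allows the residues of the theorem, which vary with n, as representatives.
ParseWords-comb-crook : ∀ m → c ⟶ a ∙ b →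
  ParseWords (pathTree (replicate (suc m) l)) (crook (2 + m)) ≐ ClassesOf (candidates m a b c)
ParseWords-comb-crook {c} {a} {b} m h =
  (λ (_ , p , u∼w) → represent p u∼w) ,
  (λ { (u , here eq , u∼w)         → u , candidate⇒bothParse m h (inj₁ eq) , u∼w
     ; (u , there (here eq) , u∼w) → u , candidate⇒bothParse m h (inj₂ eq) , u∼w })
  where
  represent : BothParse m u → u ∼ w → ClassesOf (candidates m a b c) w
  represent p u∼w with bothParse⇒candidate m p
  ... | _ , _ , _ , h′ , inj₁ refl = _ , here refl , ∼-trans
          (∼-trans (∼-sym (proj₁ (candidate∼standard m h))) (proj₁ (candidate∼standard m h′))) u∼w
  ... | _ , _ , _ , h′ , inj₂ refl = _ , there (here refl) , ∼-trans
          (∼-trans (∼-sym (proj₂ (candidate∼standard m h))) (proj₂ (candidate∼standard m h′))) u∼w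

-- Rational powers of words

floor-/ : ∀ p q → floor (+ p / suc q) ≡ + (p /ℕ suc q)
floor-/ p q = ℤ.*-identityˡ (+ (p /ℕ suc q))

-- The denominator suc q * 1 is the one that ℚᵘ subtraction produces.
power : {A : Set} → ℕ → List A → ℕ → ℕ → List A
power q w k i = concat (replicate k w) ++ take ∣ floor ((+ length w / 1) *ℚ (+ i / (suc q * 1))) ∣ w

^-power : ∀ {A : Set} (w : List A) p q → w ^ (+ p / suc q) ≡ power q w (p /ℕ suc q) (p % suc q)
^-power w p q rewrite floor-/ p q =
  cong (λ i → concat (replicate (p /ℕ suc q) w)
              ++ take ∣ floor ((+ length w / 1) *ℚ (i / (suc q * 1))) ∣ w)
    fraction
  where
  open ≡-Reasoning
  -- The left side is the unreduced numerator of `+ p / suc q` minus its floor.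
  fraction : + p *ℤ + 1 +ℤ - (+ (p /ℕ suc q)) *ℤ + suc q ≡ + (p % suc q)
  fraction = begin
    + p *ℤ + 1 +ℤ - (+ (p /ℕ suc q)) *ℤ + suc q
      ≡⟨ cong₂ _+ℤ_ (ℤ.*-identityʳ (+ p)) (sym (ℤ.neg-distribˡ-* (+ (p /ℕ suc q)) (+ suc q))) ⟩
    + p - + (p /ℕ suc q) *ℤ + suc q
      ≡⟨ cong₂ _-_ (cong +_ (m≡m%n+[m/n]*n p (suc q))) (sym (ℤ.pos-* (p /ℕ suc q) (suc q))) ⟩
    + (p % suc q) +ℤ + (p /ℕ suc q * suc q) - + (p /ℕ suc q * suc q)
      ≡⟨ ℤ.+-assoc (+ (p % suc q)) (+ (p /ℕ suc q * suc q)) (- + (p /ℕ suc q * suc q)) ⟩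
    + (p % suc q) +ℤ (+ (p /ℕ suc q * suc q) - + (p /ℕ suc q * suc q))
      ≡⟨ cong (+ (p % suc q) +ℤ_) (ℤ.+-inverseʳ (+ (p /ℕ suc q * suc q))) ⟩
    + (p % suc q) +ℤ + 0
      ≡⟨ ℤ.+-identityʳ (+ (p % suc q)) ⟩
    + (p % suc q) ∎

-- The floor of the exponent grows by one and the remainder stays, so the truncated last copy is
-- unchanged.
^-suc : ∀ {A : Set} (w : List A) p q → w ^ (+ (suc q + p) / suc q) ≡ w ++ w ^ (+ p / suc q)
^-suc w p q = begin
  w ^ (+ (suc q + p) / suc q)
    ≡⟨ ^-power w (suc q + p) q ⟩
  power q w ((suc q + p) /ℕ suc q) ((suc q + p) % suc q)
    ≡⟨ cong₂ (power q w) quotient remainder ⟩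
  power q w (suc (p /ℕ suc q)) (p % suc q)
    ≡⟨ ++-assoc w _ _ ⟩
  w ++ power q w (p /ℕ suc q) (p % suc q)
    ≡⟨ cong (w ++_) (sym (^-power w p q)) ⟩
  w ++ w ^ (+ p / suc q) ∎
  where
  open ≡-Reasoning
  quotient : (suc q + p) /ℕ suc q ≡ suc (p /ℕ suc q)
  quotient = trans (+-distrib-/-∣ˡ p (∣-refl {suc q})) (cong (_+ p /ℕ suc q) (n/n≡1 (suc q)))
  remainder : (suc q + p) % suc q ≡ p % suc q
  remainder = trans (cong (_% suc q) (+-comm (suc q) p)) ([m+n]%n≡m%n p (suc q))

cyc : ℕ → Letter
cyc j = mod₃ (+ j)

w012-^ : ∀ j → w012 ^ (+ (j * 2) / 6) ≡ applyUpTo cyc j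
w012-^ 0 = refl
w012-^ 1 = refl
w012-^ 2 = refl
w012-^ (suc (suc (suc j))) = trans (^-suc w012 (j * 2) 5) (cong (w012 ++_) (w012-^ j))

pathTree-alternating : ∀ m → pathTree ((l ∷ r ∷ []) ^ (+ m / 2)) ≡ crook (suc m)
pathTree-alternating 0 = refl
pathTree-alternating 1 = refl
pathTree-alternating (suc (suc m)) =
  trans (cong pathTree (^-suc (l ∷ r ∷ []) m 1))
        (cong (λ t → node (node leaf t) leaf) (pathTree-alternating m))

-- The words of the theorem

-- cyc (3 + j) reduces to cyc j, and (3 + j) * 2 to 6 + j * 2.
cyc-rule : ∀ j → cyc j ⟶ cyc (2 + j) ∙ cyc (1 + j)
cyc-rule 0 = 0⟶21
cyc-rule 1 = 1⟶02
cyc-rule 2 = 2⟶10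
cyc-rule (suc (suc (suc j))) = cyc-rule j

-- For n = 3 + 2j the argument is 2 - n, and at `1 + j` it is - n; modulo 3, -1 - 2j is 2 + j.
mod₃-odd : ∀ j → mod₃ -[1+ j * 2 ] ≡ cyc (2 + j)
mod₃-odd 0 = refl
mod₃-odd 1 = refl
mod₃-odd 2 = refl
mod₃-odd (suc (suc (suc j))) = mod₃-odd j

-- The same for n = 4 + 2j, with -2 - 2j congruent to 1 + j.
mod₃-even : ∀ j → mod₃ -[1+ suc (j * 2) ] ≡ cyc (1 + j)
mod₃-even 0 = refl
mod₃-even 1 = refl
mod₃-even 2 = refl
mod₃-even (suc (suc (suc j))) = mod₃-even j

assemble : ∀ u v → x ≡ a → y ≡ b → u ++ v ≡ w → [ x ] ++ u ++ v ++ [ y ] ≡ a ∷ (w ∷ʳ b)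
assemble {x} {y = y} u v refl refl refl = cong (x ∷_) (sym (++-assoc u v [ y ]))

-- Passing to the inner layer turns `a`, `b`, `c` into `b`, `c`, `a`, which lowers all indices of
-- `cyc` by one modulo 3. Hence the first letters of the layers count down and the last letters,
-- read left to right, count up.
middle-odd : ∀ j → applyDownFrom cyc (1 + j) ++ applyUpTo cyc j ≡
  middle (j * 2) (cyc (2 + j)) (cyc (1 + j)) (cyc j)
middle-odd zero = refl
middle-odd (suc j) = cong (cyc (1 + j) ∷_) (begin
  applyDownFrom cyc (1 + j) ++ applyUpTo cyc (1 + j)
    ≡⟨ cong (applyDownFrom cyc (1 + j) ++_) (sym (applyUpTo-∷ʳ cyc j)) ⟩
  applyDownFrom cyc (1 + j) ++ (applyUpTo cyc j ∷ʳ cyc j)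
    ≡⟨ sym (++-assoc (applyDownFrom cyc (1 + j)) _ _) ⟩
  (applyDownFrom cyc (1 + j) ++ applyUpTo cyc j) ∷ʳ cyc j
    ≡⟨ cong (_∷ʳ cyc j) (middle-odd j) ⟩
  middle (j * 2) (cyc (2 + j)) (cyc (1 + j)) (cyc j) ∷ʳ cyc j ∎)
  where open ≡-Reasoning

-- Here the layers surround the core 0 1, so the last letters continue the count from 2.
middle-even : ∀ j → applyDownFrom cyc j ++ applyUpTo cyc (2 + j) ≡
  middle (1 + j * 2) (cyc (1 + j)) (cyc j) (cyc (2 + j))
middle-even zero = refl
middle-even (suc j) = cong (cyc j ∷_) (begin
  applyDownFrom cyc j ++ applyUpTo cyc (3 + j)
    ≡⟨ cong (applyDownFrom cyc j ++_) (sym (applyUpTo-∷ʳ cyc (2 + j))) ⟩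
  applyDownFrom cyc j ++ (applyUpTo cyc (2 + j) ∷ʳ cyc (2 + j))
    ≡⟨ sym (++-assoc (applyDownFrom cyc j) _ _) ⟩
  (applyDownFrom cyc j ++ applyUpTo cyc (2 + j)) ∷ʳ cyc (2 + j)
    ≡⟨ cong (_∷ʳ cyc (2 + j)) (middle-even j) ⟩
  middle (1 + j * 2) (cyc (1 + j)) (cyc j) (cyc (2 + j)) ∷ʳ cyc (2 + j) ∎)
  where open ≡-Reasoning

odd-case : ∀ j → let n = 3 + j * 2 in
  ParseWords (LeftCombTree n) (LeftCrookedTree n) ≐
  ClassesOf
    ( ([ mod₃ (+ 2 - + n) ] ++ reverse (w012 ^ ((+ n - + 1) / 6)) ++ w012 ^ ((+ n - + 3) / 6) ++ [ mod₃ (+ 2 - + n) ])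
    ∷ ([ mod₃ (+ 2 - + n) ] ++ reverse (w012 ^ ((+ n - + 1) / 6)) ++ w012 ^ ((+ n - + 3) / 6) ++ [ mod₃ (- (+ n)) ])
    ∷ [])
odd-case j
  = subst₂ (λ t ws → ParseWords (LeftCombTree (3 + j * 2)) t ≐ ClassesOf ws)
      (sym (pathTree-alternating (1 + j * 2)))
      (sym (cong₂ (λ w w′ → w ∷ w′ ∷ [])
        (assemble down up (mod₃-odd j) (mod₃-odd j) centre)
        (assemble down up (mod₃-odd j) (mod₃-odd (1 + j)) centre)))
      (ParseWords-comb-crook (j * 2) (cyc-rule j))
  where
  down = reverse (w012 ^ (+ ((1 + j) * 2) / 6))
  up = w012 ^ (+ (j * 2) / 6)
  centre : down ++ up ≡ middle (j * 2) (cyc (2 + j)) (cyc (1 + j)) (cyc j)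
  centre = trans
    (cong₂ _++_ (trans (cong reverse (w012-^ (1 + j))) (reverse-applyUpTo cyc (1 + j))) (w012-^ j))
    (middle-odd j)

even-case : ∀ j → let n = 4 + j * 2 in
  ParseWords (LeftCombTree n) (LeftCrookedTree n) ≐
  ClassesOf
    ( ([ mod₃ (+ 2 - + n) ] ++ reverse (w012 ^ ((+ n - + 4) / 6)) ++ w012 ^ (+ n / 6) ++ [ mod₃ (+ 2 - + n) ])
    ∷ ([ mod₃ (+ 2 - + n) ] ++ reverse (w012 ^ ((+ n - + 4) / 6)) ++ w012 ^ (+ n / 6) ++ [ mod₃ (- (+ n)) ])
    ∷ [])
even-case j
  = subst₂ (λ t ws → ParseWords (LeftCombTree (4 + j * 2)) t ≐ ClassesOf ws)
      (sym (pathTree-alternating (2 + j * 2)))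
      (sym (cong₂ (λ w w′ → w ∷ w′ ∷ [])
        (assemble down up (mod₃-even j) (mod₃-even j) centre)
        (assemble down up (mod₃-even j) (mod₃-even (1 + j)) centre)))
      (ParseWords-comb-crook (1 + j * 2) (⟶-rotate (cyc-rule j)))
  where
  down = reverse (w012 ^ (+ (j * 2) / 6))
  up = w012 ^ (+ ((2 + j) * 2) / 6)
  centre : down ++ up ≡ middle (1 + j * 2) (cyc (1 + j)) (cyc j) (cyc (2 + j))
  centre = trans
    (cong₂ _++_ (trans (cong reverse (w012-^ j)) (reverse-applyUpTo cyc j)) (w012-^ (2 + j)))
    (middle-even j)

odd-view : ∀ {n} → 3 ≤ n → 2 ∤ n → ∃[ j ] n ≡ 3 + j * 2
odd-view {n} 3≤n 2∤n with n % 2 | n /ℕ 2 | m≡m%n+[m/n]*n n 2 | m%n<n n 2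
... | 0 | q     | eq   | _ = ⊥-elim (2∤n (divides q eq))
... | 1 | suc j | eq   | _ = j , eq
odd-view (s≤s ()) _ | 1 | zero | refl | _
... | suc (suc _) | _ | _ | s≤s (s≤s ())

even-view : ∀ {n} → 4 ≤ n → 2 ∣ n → ∃[ j ] n ≡ 4 + j * 2
even-view ()                (divides 0 refl)
even-view (s≤s (s≤s ()))    (divides 1 refl)
even-view _                 (divides (suc (suc j)) eq) = j , eq

theorem7 : (n : ℕ) → 3 ≤ n →
    (2 ∤ n →
    ParseWords (LeftCombTree n) (LeftCrookedTree n) ≐
    ClassesOf
    ( ([ mod₃ (+ 2 - + n) ] ++ reverse (w012 ^ ((+ n - + 1) / 6)) ++ w012 ^ ((+ n - + 3) / 6) ++ [ mod₃ (+ 2 - + n) ])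
    ∷ ([ mod₃ (+ 2 - + n) ] ++ reverse (w012 ^ ((+ n - + 1) / 6)) ++ w012 ^ ((+ n - + 3) / 6) ++ [ mod₃ (- (+ n)) ])
    ∷ []))
    ×
    (4 ≤ n → 2 ∣ n →
    ParseWords (LeftCombTree n) (LeftCrookedTree n) ≐
    ClassesOf
    ( ([ mod₃ (+ 2 - + n) ] ++ reverse (w012 ^ ((+ n - + 4) / 6)) ++ w012 ^ (+ n / 6) ++ [ mod₃ (+ 2 - + n) ])
    ∷ ([ mod₃ (+ 2 - + n) ] ++ reverse (w012 ^ ((+ n - + 4) / 6)) ++ w012 ^ (+ n / 6) ++ [ mod₃ (- (+ n)) ])
    ∷ []))
theorem7 n 3≤n = odd , even
  where
  odd : 2 ∤ n → _
  odd 2∤n with j , refl ← odd-view 3≤n 2∤n = odd-case j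
  even : 4 ≤ n → 2 ∣ n → _
  even 4≤n 2∣n with j , refl ← even-view 4≤n 2∣n = even-case j
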